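{- Let $k\ge1$ be an integer. We have $$N^{k(k-1)\cdots1}_{2\text{ - }13}(n)=\begin{cases}C_{n-k+1},&\text{if }n\ge k,\\ 0,&\text{otherwise.}\end{cases}$$
   Context: A permutation $\pi=\pi_1\cdots\pi_n$ of $\{1,\dots,n\}$ contains the generalized pattern $2\text{ - }13$ if there are indices $i<j<n$ such that $\pi_i\pi_j\pi_{j+1}$ is order-isomorphic to $213$; otherwise it avoids it. A permutation $\pi$ begins with a pattern $p=p_1\cdots p_k$ if $n\ge k$ and $\pi_1\cdots\pi_k$ is order-isomorphic to $p$; in addition, by convention, the empty permutation is assumed to begin with the pattern $1$. $N^p_q(n)$ is the number of permutations of $\{1,\dots,n\}$ that avoid $q$ and begin with $p$. $C_m=\frac{1}{m+1}\binom{2m}{m}$ is the $m$th Catalan number.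
   Formalization: The case k = 1, n = 0 is excluded: by the convention that the empty permutation begins with the pattern 1, the count there is 1, whereas the displayed formula gives 0. -}

module Defs where

open import Data.Fin as Fin using (Fin; toℕ)
open import Data.Fin.Properties as Finₚ using (any?; all?)
open import Data.List as List using (List; cartesianProductWith; allFin; filter; length)
open import Data.List.Properties as Listₚ using ()
open import Data.Nat using (ℕ; zero; suc; _*_; _/_; _<_; _≤_; _≤?_; _<?_; _≟_)
open import Data.Nat.Combinatorics using (_C_)
open import Data.Nat.Properties using (≤-irrelevant)
open import Data.Product using (Σ-syntax; ∃-syntax; _×_; _,_)
open import Data.Sum using (_⊎_)
open import Data.Vec using (Vec; []; _∷_; lookup; map; toList; truncate)
open import Data.Vec.Relation.Unary.AllPairs using (allPairs?)
open import Data.Vec.Relation.Unary.Unique.Propositional using (Unique)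
open import Function using (_⇔_; mk⇔; Equivalence)
open import Relation.Binary.PropositionalEquality using (_≡_; subst)
open import Relation.Nullary using (¬_; Dec; yes; no)
open import Relation.Nullary.Decidable using (map′; ¬?; _×-dec_; _⊎-dec_; _→-dec_)

OrderIsomorphic : ∀ {m} → Vec ℕ m → Vec ℕ m → Set
OrderIsomorphic u v = ∀ a b → lookup u a < lookup u b ⇔ lookup v a < lookup v b

-- Permutations are in one-line notation, with the letters 1, …, n shifted
-- down to 0, …, n - 1.  A word of length n over n letters is a permutation
-- exactly when its letters are distinct.
IsPermutation : ∀ {n} → Vec (Fin n) n → Set
IsPermutation = Unique

Contains-2-13 : ∀ {n} → Vec (Fin n) n → Set
Contains-2-13 {n} π =
  ∃[ i ] ∃[ j ] ∃[ j′ ] i Fin.< j × toℕ j′ ≡ suc (toℕ j) ×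
    OrderIsomorphic (map toℕ (lookup π i ∷ lookup π j ∷ lookup π j′ ∷ []))
                    (2 ∷ 1 ∷ 3 ∷ [])

Avoids-2-13 : ∀ {n} → Vec (Fin n) n → Set
Avoids-2-13 π = ¬ Contains-2-13 π

-- The second alternative is the convention that the empty permutation
-- begins with the pattern 1.
BeginsWith : ∀ {k n} → Vec ℕ k → Vec (Fin n) n → Set
BeginsWith {k} {n} p π =
  (Σ[ k≤n ∈ k ≤ n ] OrderIsomorphic (map toℕ (truncate k≤n π)) p)
  ⊎ (n ≡ 0 × toList p ≡ 1 List.∷ List.[])

orderIsomorphic? : ∀ {m} (u v : Vec ℕ m) → Dec (OrderIsomorphic u v)
orderIsomorphic? u v = all? λ a → all? λ b →
  let l? = lookup u a <? lookup u b
      r? = lookup v a <? lookup v b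
  in map′ (λ (f , g) → mk⇔ f g) (λ e → Equivalence.to e , Equivalence.from e)
          ((l? →-dec r?) ×-dec (r? →-dec l?))

isPermutation? : ∀ {n} (π : Vec (Fin n) n) → Dec (IsPermutation π)
isPermutation? = allPairs? λ x y → ¬? (x Finₚ.≟ y)

avoids-2-13? : ∀ {n} (π : Vec (Fin n) n) → Dec (Avoids-2-13 π)
avoids-2-13? π = ¬? (any? λ i → any? λ j → any? λ j′ →
  (i Finₚ.<? j) ×-dec (toℕ j′ ≟ suc (toℕ j)) ×-dec
  orderIsomorphic? (map toℕ (lookup π i ∷ lookup π j ∷ lookup π j′ ∷ []))
                   (2 ∷ 1 ∷ 3 ∷ []))

beginsWith? : ∀ {k n} (p : Vec ℕ k) (π : Vec (Fin n) n) → Dec (BeginsWith p π)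
beginsWith? {k} {n} p π =
  prefix? ⊎-dec ((n ≟ 0) ×-dec Listₚ.≡-dec _≟_ (toList p) (1 List.∷ List.[]))
  where
  Prefix : k ≤ n → Set
  Prefix k≤n = OrderIsomorphic (map toℕ (truncate k≤n π)) p

  prefix? : Dec (Σ[ k≤n ∈ k ≤ n ] Prefix k≤n)
  prefix? with k ≤? n
  ... | yes k≤n = map′ (k≤n ,_)
                       (λ (le , iso) → subst Prefix (≤-irrelevant le k≤n) iso)
                       (orderIsomorphic? (map toℕ (truncate k≤n π)) p)
  ... | no  k≰n = no λ (k≤n , _) → k≰n k≤n

-- Every word of length m over Fin n, each listed exactly once.
words : ∀ n m → List (Vec (Fin n) m)
words n zero    = [] List.∷ List.[]
words n (suc m) = cartesianProductWith _∷_ (allFin n) (words n m)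

Counted : ∀ {k n} → Vec ℕ k → Vec (Fin n) n → Set
Counted p π = IsPermutation π × Avoids-2-13 π × BeginsWith p π

counted? : ∀ {k n} (p : Vec ℕ k) (π : Vec (Fin n) n) → Dec (Counted p π)
counted? p π = isPermutation? π ×-dec avoids-2-13? π ×-dec beginsWith? p π

N-2-13 : ∀ {k} → Vec ℕ k → ℕ → ℕ
N-2-13 p n = length (filter (counted? p) (words n n))

decreasing : ∀ k → Vec ℕ k
decreasing zero    = []
decreasing (suc k) = suc k ∷ decreasing k

-- The division is exact.
catalan : ℕ → ℕ
catalan m = ((2 * m) C m) / suc m

{-# OPTIONS --safe #-}

-- After its first letter x, a word avoiding 2-13 first uses up all the letters above x
-- and only then those below x, since an ascent across x would complete the pattern.
-- Hence the avoiding permutations of an interval are the preorder words of the binary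
-- trees whose node with letter x carries the larger letters in one subtree and the
-- smaller letters in the other.  A permutation begins with k … 1 exactly when the first
-- k - 1 nodes on the branch of smaller letters carry no larger letters, which leaves an
-- arbitrary tree of size n - k + 1.  Trees are counted through forests, whose numbers
-- satisfy the recurrence of the ballot numbers.
module Submission where

open import Defs
open import Data.Fin as Fin using (Fin; toℕ; fromℕ<)
open import Data.Fin.Properties using (toℕ-injective; toℕ<n; toℕ-fromℕ<)
open import Data.List as List using (List; []; _∷_; _++_; length; take; applyUpTo; filter)
open import Data.List.Membership.DecPropositional using (_∈?_)
open import Data.List.Membership.Propositional using (_∈_)
open import Data.List.Membership.Propositional.Properties
  using (∈-map⁺; ∈-map⁻; ∈-++⁺ˡ; ∈-++⁺ʳ; ∈-filter⁺; ∈-filter⁻;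
         ∈-applyUpTo⁺; ∈-cartesianProductWith⁺; ∈-allFin)
open import Data.List.Membership.Propositional.Properties.WithK using (unique∧set⇒bag)
open import Data.List.Properties
  using (∷-injective; length-++; length-map;
         length-filter; length-applyUpTo; filter-none)
open import Data.List.Relation.Binary.BagAndSetEquality using (∼bag⇒↭)
open import Data.List.Relation.Binary.Permutation.Propositional.Properties using (↭-length)
open import Data.List.Relation.Unary.All as All using (All; []; _∷_)
import Data.List.Relation.Unary.All.Properties as Allₚ
open import Data.List.Relation.Unary.AllPairs using (AllPairs; []; _∷_)
import Data.List.Relation.Unary.AllPairs.Properties as AllPairsₚ
open import Data.List.Relation.Unary.Any using (here)
open import Data.List.Relation.Unary.Linked as Linked using (Linked; []; [-]; _∷_)
open import Data.List.Relation.Unary.Unique.Propositional using (Unique)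
import Data.List.Relation.Unary.Unique.Propositional.Properties as Uniqueₚ
open import Data.Nat
  using (ℕ; zero; suc; pred; _+_; _*_; _∸_; _/_; _≤_; _<_; _>_; _≥_;
         z≤n; s≤s; z<s; s<s; s≤s⁻¹; s<s⁻¹)
open import Data.Nat.Combinatorics using (_C_; nCk+nC[k+1]≡[n+1]C[k+1]; nCk≡nC[n∸k]; nC1≡n)
open import Data.Nat.DivMod using (m*n/n≡m)
open import Data.Nat.Properties
open import Data.Nat.Tactic.RingSolver using (solve-∀)
open import Data.Product using (_×_; _,_; proj₁; proj₂; ∃; ∃₂)
open import Data.Sum using (inj₁; inj₂)
open import Data.Unit using (⊤; tt)
open import Data.Vec as Vec using (Vec; []; _∷_; lookup; toList; truncate)
open import Data.Vec.Properties using (lookup-map; length-toList) renaming (∷-injective to ∷ᵛ-injective)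
import Data.Vec.Relation.Unary.All as VecAll
import Data.Vec.Relation.Unary.All.Properties as VecAllₚ
import Data.Vec.Relation.Unary.AllPairs as VecAllPairs
open import Function using (_∘_; _⇔_; mk⇔; Equivalence)
open import Relation.Binary.Definitions using (tri<; tri≈; tri>)
open import Relation.Binary.PropositionalEquality
open import Relation.Nullary using (¬_; contradiction)

-- Binomial coefficients

-- Induction on `n`: Pascal's rule splits the left side so that the induction hypothesis applies at
-- `k` and at `suc k`, and a second use of it reassembles the right side.
C-absorb : ∀ n k → suc k * (suc n C suc k) ≡ suc n * (n C k)
C-absorb n zero = begin
  1 * (suc n C 1)  ≡⟨ *-identityˡ _ ⟩
  suc n C 1        ≡⟨ nC1≡n (suc n) ⟩
  suc n            ≡⟨ *-identityʳ _ ⟨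
  suc n * (n C 0)  ∎
  where open ≡-Reasoning
C-absorb zero (suc k) = *-zeroʳ (2 + k)
C-absorb (suc n) (suc k) = begin
  (2 + k) * (suc (suc n) C (2 + k))
    ≡⟨ cong ((2 + k) *_) (nCk+nC[k+1]≡[n+1]C[k+1] (suc n) (suc k)) ⟨
  (2 + k) * (c + d)
    ≡⟨ *-distribˡ-+ (2 + k) c d ⟩
  c + suc k * c + (2 + k) * d
    ≡⟨ cong₂ (λ a b → c + a + b) (C-absorb n k) (C-absorb n (suc k)) ⟩
  c + suc n * (n C k) + suc n * (n C suc k)
    ≡⟨ +-assoc c _ _ ⟩
  c + (suc n * (n C k) + suc n * (n C suc k))
    ≡⟨ cong (c +_) (*-distribˡ-+ (suc n) (n C k) (n C suc k)) ⟨
  c + suc n * (n C k + n C suc k)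
    ≡⟨ cong (λ a → c + suc n * a) (nCk+nC[k+1]≡[n+1]C[k+1] n k) ⟩
  suc (suc n) * c ∎
  where
  open ≡-Reasoning
  c = suc n C suc k
  d = suc n C suc (suc k)

-- The ratio of neighbouring entries in a row. Pascal's rule and absorption both evaluate
-- `suc k * (suc (a + k) C suc k)`, and the common summand `suc k * c` cancels.
C-step : ∀ a k → suc k * ((a + k) C suc k) ≡ a * ((a + k) C k)
C-step a k = +-cancelˡ-≡ (suc k * c) _ _ (begin
  suc k * c + suc k * ((a + k) C suc k)
    ≡⟨ *-distribˡ-+ (suc k) c _ ⟨
  suc k * (c + (a + k) C suc k)
    ≡⟨ cong (suc k *_) (nCk+nC[k+1]≡[n+1]C[k+1] (a + k) k) ⟩
  suc k * (suc (a + k) C suc k)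
    ≡⟨ C-absorb (a + k) k ⟩
  suc (a + k) * c
    ≡⟨ distrib a k c ⟩
  suc k * c + a * c ∎)
  where
  open ≡-Reasoning
  c = (a + k) C k
  distrib : ∀ a k c → suc (a + k) * c ≡ suc k * c + a * c
  distrib = solve-∀

-- The two middle entries of an odd row agree by symmetry. This settles the forests without trees,
-- of which none has positive size.
C-middle : ∀ m → suc (2 * m) C m ≡ suc (2 * m) C suc m
C-middle m = trans (nCk≡nC[n∸k] {m} {suc (2 * m)} m≤) (cong (suc (2 * m) C_) ∸≡)
  where
  m≤ : m ≤ suc (2 * m)
  m≤ = m≤n⇒m≤1+n (m≤m+n m _)
  split-odd : ∀ m → suc (2 * m) ≡ suc m + m
  split-odd = solve-∀
  ∸≡ : suc (2 * m) ∸ m ≡ suc m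
  ∸≡ = trans (cong (_∸ m) (split-odd m)) (m+n∸n≡m (suc m) m)

-- Binary trees and forests

data Tree : Set where
  leaf : Tree
  node : Tree → Tree → Tree

size : Tree → ℕ
size leaf       = 0
size (node l r) = suc (size l + size r)

node-injective : ∀ {l r l′ r′} → node l r ≡ node l′ r′ → l ≡ l′ × r ≡ r′
node-injective refl = refl , refl

total : ∀ {h} → Vec Tree h → ℕ
total []       = 0
total (t ∷ ts) = size t + total ts

graft : ∀ {h} → Vec Tree (2 + h) → Vec Tree (1 + h)
graft (l ∷ r ∷ ts) = node l r ∷ ts

graft-injective : ∀ {h} {ts us : Vec Tree (2 + h)} → graft ts ≡ graft us → ts ≡ us
graft-injective {ts = _ ∷ _ ∷ _} {_ ∷ _ ∷ _} refl = refl

-- The first tree is either a leaf, which is dropped, or a node, whose root is cut off to leave two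
-- trees. This yields a recurrence with two summands in place of the Catalan convolution.
forests : ∀ h → ℕ → List (Vec Tree h)
forests zero    zero    = [] ∷ []
forests zero    (suc m) = []
forests (suc h) zero    = List.map (leaf ∷_) (forests h zero)
forests (suc h) (suc m) =
  List.map (leaf ∷_) (forests h (suc m)) ++ List.map graft (forests (2 + h) m)

forests-unique : ∀ h m → Unique (forests h m)
forests-unique zero    zero    = [] ∷ []
forests-unique zero    (suc m) = []
forests-unique (suc h) zero    = Uniqueₚ.map⁺ (proj₂ ∘ ∷ᵛ-injective) (forests-unique h zero)
forests-unique (suc h) (suc m) = Uniqueₚ.++⁺
  (Uniqueₚ.map⁺ (proj₂ ∘ ∷ᵛ-injective) (forests-unique h (suc m)))
  (Uniqueₚ.map⁺ graft-injective (forests-unique (2 + h) m))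
  disjoint
  where
  disjoint : ∀ {ts} → ¬ (ts ∈ List.map (leaf ∷_) (forests h (suc m)) ×
                         ts ∈ List.map graft (forests (2 + h) m))
  disjoint (p , q) with ∈-map⁻ (leaf ∷_) p | ∈-map⁻ graft q
  ... | _ , _ , refl | _ ∷ _ ∷ _ , _ , ()

∈-forests⁺ : ∀ h m (ts : Vec Tree h) → total ts ≡ m → ts ∈ forests h m
∈-forests⁺ zero    zero    []              _  = here refl
∈-forests⁺ (suc h) zero    (leaf ∷ ts)     eq = ∈-map⁺ _ (∈-forests⁺ h zero ts eq)
∈-forests⁺ (suc h) (suc m) (leaf ∷ ts)     eq = ∈-++⁺ˡ (∈-map⁺ _ (∈-forests⁺ h (suc m) ts eq))
∈-forests⁺ (suc h) (suc m) (node l r ∷ ts) eq =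
  ∈-++⁺ʳ _ (∈-map⁺ graft (∈-forests⁺ (2 + h) m (l ∷ r ∷ ts)
    (trans (sym (+-assoc (size l) (size r) (total ts))) (cong pred eq))))

total-graft : ∀ {h} (ts : Vec Tree (2 + h)) → total (graft ts) ≡ suc (total ts)
total-graft (l ∷ r ∷ ts) = cong suc (+-assoc (size l) (size r) (total ts))

forests-total : ∀ h m → All (λ ts → total ts ≡ m) (forests h m)
forests-total zero    zero    = refl ∷ []
forests-total zero    (suc m) = []
forests-total (suc h) zero    = Allₚ.map⁺ (forests-total h zero)
forests-total (suc h) (suc m) = Allₚ.++⁺
  (Allₚ.map⁺ (forests-total h (suc m)))
  (Allₚ.map⁺ (All.map (λ {ts} eq → trans (total-graft ts) (cong suc eq))
                      (forests-total (2 + h) m)))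

-- Ballot and Catalan numbers

forestCount : ℕ → ℕ → ℕ
forestCount h m = length (forests h m)

forestCount-zero : ∀ h → forestCount h 0 ≡ 1
forestCount-zero zero    = refl
forestCount-zero (suc h) = trans (length-map _ (forests h 0)) (forestCount-zero h)

forestCount-suc : ∀ h m →
  forestCount (suc h) (suc m) ≡ forestCount h (suc m) + forestCount (2 + h) m
forestCount-suc h m = trans (length-++ (List.map (leaf ∷_) (forests h (suc m))))
  (cong₂ _+_ (length-map _ (forests h (suc m))) (length-map graft (forests (2 + h) m)))

-- The ballot numbers as differences of neighbouring binomial coefficients.
forestCount-C : ∀ m h →
  forestCount h (suc m) + (suc (2 * m) + h) C m ≡ (suc (2 * m) + h) C suc m
forestCount-C m zero =
  subst (λ n → n C m ≡ n C suc m) (sym (+-identityʳ _)) (C-middle m)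
forestCount-C m (suc h) =
  subst (λ n → forestCount (suc h) (suc m) + n C m ≡ n C suc m)
        (sym (+-suc (suc (2 * m)) h)) (begin
    forestCount (suc h) (suc m) + suc L C m
      ≡⟨ cong (_+ suc L C m) (forestCount-suc h m) ⟩
    forestCount h (suc m) + forestCount (2 + h) m + suc L C m
      ≡⟨ +-assoc (forestCount h (suc m)) _ _ ⟩
    forestCount h (suc m) + (forestCount (2 + h) m + suc L C m)
      ≡⟨ cong (forestCount h (suc m) +_) (lower m) ⟩
    forestCount h (suc m) + (L′ m C m + L′ m C m)
      ≡⟨ +-assoc (forestCount h (suc m)) _ _ ⟨
    forestCount h (suc m) + L C m + L C m
      ≡⟨ cong (_+ L C m) (forestCount-C m h) ⟩
    L C suc m + L C m
      ≡⟨ +-comm (L C suc m) _ ⟩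
    L C m + L C suc m
      ≡⟨ nCk+nC[k+1]≡[n+1]C[k+1] L m ⟩
    suc L C suc m ∎)
  where
  open ≡-Reasoning
  L′ : ℕ → ℕ
  L′ m = suc (2 * m) + h
  L = L′ m
  -- Two more trees and one node fewer leave the upper index unchanged.
  regroup : ∀ m h → suc (2 * m) + (2 + h) ≡ suc (2 * suc m) + h
  regroup = solve-∀
  -- The formula speaks of positive sizes only, so size zero is separate, with count and binomial
  -- both 1. Otherwise Pascal's rule splits off the binomial that the induction hypothesis absorbs.
  lower : ∀ m → forestCount (2 + h) m + suc (L′ m) C m ≡ L′ m C m + L′ m C m
  lower zero    = cong (_+ 1) (forestCount-zero (2 + h))
  lower (suc m) = begin
    forestCount (2 + h) (suc m) + suc M C suc m
      ≡⟨ cong (forestCount (2 + h) (suc m) +_) (nCk+nC[k+1]≡[n+1]C[k+1] M m) ⟨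
    forestCount (2 + h) (suc m) + (M C m + M C suc m)
      ≡⟨ +-assoc (forestCount (2 + h) (suc m)) _ _ ⟨
    forestCount (2 + h) (suc m) + M C m + M C suc m
      ≡⟨ cong (_+ M C suc m)
           (subst (λ n → forestCount (2 + h) (suc m) + n C m ≡ n C suc m)
                  (regroup m h) (forestCount-C m (2 + h))) ⟩
    M C suc m + M C suc m ∎
    where M = L′ (suc m)

-- The count is `f` = c - d, and `c∼d` makes this difference the (m + 2)nd part of `c`. Adding
-- `(2 + m) * d` to both sides avoids subtraction.
forestCount≡catalan : ∀ m → forestCount 1 m ≡ catalan m
forestCount≡catalan zero    = refl
forestCount≡catalan (suc m) = begin
  f                                ≡⟨ m*n/n≡m f (2 + m) ⟨
  f * (2 + m) / (2 + m)            ≡⟨ cong (_/ (2 + m)) product ⟩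
  ((2 * suc m) C suc m) / (2 + m)  ∎
  where
  open ≡-Reasoning
  f = forestCount 1 (suc m)
  c = (2 * suc m) C suc m
  d = (2 * suc m) C m

  double : ∀ m → suc (2 * m) + 1 ≡ 2 * suc m
  double = solve-∀
  f+d≡c : f + d ≡ c
  f+d≡c = subst (λ n → f + n C m ≡ n C suc m) (double m) (forestCount-C m 1)

  double′ : ∀ m → (2 + m) + m ≡ 2 * suc m
  double′ = solve-∀
  c∼d : suc m * c ≡ (2 + m) * d
  c∼d = subst (λ n → suc m * (n C suc m) ≡ (2 + m) * (n C m)) (double′ m) (C-step (2 + m) m)

  product : f * (2 + m) ≡ c
  product = +-cancelʳ-≡ ((2 + m) * d) _ _ (begin
    f * (2 + m) + (2 + m) * d  ≡⟨ factor f d m ⟩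
    (2 + m) * (f + d)          ≡⟨ cong ((2 + m) *_) f+d≡c ⟩
    c + suc m * c              ≡⟨ cong (c +_) c∼d ⟩
    c + (2 + m) * d            ∎)
    where
    factor : ∀ f d m → f * (2 + m) + (2 + m) * d ≡ (2 + m) * (f + d)
    factor = solve-∀

trees : ℕ → List Tree
trees m = List.map Vec.head (forests 1 m)

trees-unique : ∀ m → Unique (trees m)
trees-unique m = Uniqueₚ.map⁺ head-injective (forests-unique 1 m)
  where
  head-injective : ∀ {ts us : Vec Tree 1} → Vec.head ts ≡ Vec.head us → ts ≡ us
  head-injective {_ ∷ []} {_ ∷ []} refl = refl

∈-trees⁺ : ∀ {t m} → size t ≡ m → t ∈ trees m
∈-trees⁺ {t} {m} eq =
  ∈-map⁺ Vec.head (∈-forests⁺ 1 m (t ∷ []) (trans (+-identityʳ (size t)) eq))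

∈-trees⁻ : ∀ {t m} → t ∈ trees m → size t ≡ m
∈-trees⁻ {m = m} t∈ with ∈-map⁻ Vec.head t∈
... | u ∷ [] , u∈ , refl =
  trans (sym (+-identityʳ (size u))) (All.lookup (forests-total 1 m) u∈)

length-trees : ∀ m → length (trees m) ≡ catalan m
length-trees m = trans (length-map Vec.head (forests 1 m)) (forestCount≡catalan m)

-- Lists without repetition

-- Without repetition, equal membership is bag equality, so each list is a rearrangement of the
-- other.
length-cong-∈ : ∀ {A : Set} {xs ys : List A} → Unique xs → Unique ys →
  (∀ {x} → x ∈ xs → x ∈ ys) → (∀ {x} → x ∈ ys → x ∈ xs) → length xs ≡ length ys
length-cong-∈ xs! ys! to from =
  ↭-length (∼bag⇒↭ (unique∧set⇒bag xs! ys! (mk⇔ to from)))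

Between : ℕ → ℕ → ℕ → Set
Between lo hi x = lo ≤ x × x < hi

-- `xs` has the same members as the part of the range that occurs in `xs`, and that part is no
-- longer than the range.
pigeonhole : ∀ {lo hi xs} → lo ≤ hi → Unique xs → All (Between lo hi) xs → lo + length xs ≤ hi
pigeonhole {lo} {hi} {xs} lo≤hi xs! bounds = begin
  lo + length xs         ≡⟨ cong (lo +_) (length-cong-∈ xs! (Uniqueₚ.filter⁺ in? range!) to from) ⟩
  lo + length (filter in? range)  ≤⟨ +-monoʳ-≤ lo (length-filter in? range) ⟩
  lo + length range      ≡⟨ cong (lo +_) (length-applyUpTo (lo +_) (hi ∸ lo)) ⟩
  lo + (hi ∸ lo)         ≡⟨ m+[n∸m]≡n lo≤hi ⟩
  hi                     ∎
  where
  open ≤-Reasoning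
  range = applyUpTo (lo +_) (hi ∸ lo)
  in? = λ x → _∈?_ _≟_ x xs

  range! : Unique range
  range! = Uniqueₚ.applyUpTo⁺₁ (lo +_) (hi ∸ lo) (λ i<j _ eq → <⇒≢ i<j (+-cancelˡ-≡ lo _ _ eq))

  to : ∀ {x} → x ∈ xs → x ∈ filter in? range
  to x∈ with All.lookup bounds x∈
  ... | lo≤x , x<hi = ∈-filter⁺ in?
    (subst (_∈ range) (m+[n∸m]≡n lo≤x) (∈-applyUpTo⁺ (lo +_) (∸-monoˡ-< x<hi lo≤x))) x∈

  from : ∀ {x} → x ∈ filter in? range → x ∈ xs
  from x∈ = proj₂ (∈-filter⁻ in? {xs = range} x∈)

AllPairs-++⁻ : ∀ {A : Set} {R : A → A → Set} xs {ys} →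
  AllPairs R (xs ++ ys) → AllPairs R xs × AllPairs R ys
AllPairs-++⁻ []       rs       = [] , rs
AllPairs-++⁻ (x ∷ xs) (r ∷ rs) with AllPairs-++⁻ xs rs
... | rxs , rys = Allₚ.++⁻ˡ xs r ∷ rxs , rys

++-injective : ∀ {A : Set} (xs xs′ : List A) {ys ys′} → length xs ≡ length xs′ →
  xs ++ ys ≡ xs′ ++ ys′ → xs ≡ xs′ × ys ≡ ys′
++-injective []       []         _    eq = refl , eq
++-injective (x ∷ xs) (x′ ∷ xs′) len≡ eq with ∷-injective eq
... | refl , eq′ with ++-injective xs xs′ (cong pred len≡) eq′
...   | refl , ys≡ = refl , ys≡

-- Words avoiding 2-13

NoAscentAcross : ℕ → List ℕ → Set
NoAscentAcross x = Linked (λ y z → ¬ (y < x × x < z))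

-- One condition for each letter in the role of the 2, so that avoidance can be taken apart along
-- the list.
Avoids : List ℕ → Set
Avoids []       = ⊤
Avoids (x ∷ xs) = NoAscentAcross x xs × Avoids xs

allBelow⇒noAscentAcross : ∀ {x ys} → All (_< x) ys → NoAscentAcross x ys
allBelow⇒noAscentAcross []              = []
allBelow⇒noAscentAcross (_ ∷ [])        = [-]
allBelow⇒noAscentAcross (_ ∷ z<x ∷ ys<) =
  (λ (_ , x<z) → <-asym x<z z<x) ∷ allBelow⇒noAscentAcross (z<x ∷ ys<)

allAbove⇒noAscentAcross : ∀ {x ys} → All (x <_) ys → NoAscentAcross x ys
allAbove⇒noAscentAcross []              = []
allAbove⇒noAscentAcross (_ ∷ [])        = [-]
allAbove⇒noAscentAcross (x<y ∷ <z ∷ ys) =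
  (λ (y<x , _) → <-asym x<y y<x) ∷ allAbove⇒noAscentAcross (<z ∷ ys)

-- Each step into or within `vs` ends below `x`, so it cannot cross `x` upwards.
noAscentAcross-++⁺ : ∀ {x us vs} → NoAscentAcross x us → All (_< x) vs →
  NoAscentAcross x (us ++ vs)
noAscentAcross-++⁺ []       vs<         = allBelow⇒noAscentAcross vs<
noAscentAcross-++⁺ [-]      []          = [-]
noAscentAcross-++⁺ [-]      (v<x ∷ vs<) =
  (λ (_ , x<v) → <-asym x<v v<x) ∷ allBelow⇒noAscentAcross (v<x ∷ vs<)
noAscentAcross-++⁺ (r ∷ rs) vs<         = r ∷ noAscentAcross-++⁺ rs vs<

-- If the 2 lies in `us`, the larger 3 cannot lie in `vs`, so the whole occurrence stays in `us`.
-- Otherwise it lies in `vs`.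
avoids-++⁺ : ∀ us {vs} → Avoids us → Avoids vs → All (λ u → All (_< u) vs) us →
  Avoids (us ++ vs)
avoids-++⁺ []       _          av-vs _              = av-vs
avoids-++⁺ (u ∷ us) (na , av) av-vs (vs<u ∷ vs<us) =
  noAscentAcross-++⁺ na vs<u , avoids-++⁺ us av av-vs vs<us

linked-++⁻ˡ : ∀ {A : Set} {R : A → A → Set} xs {ys} → Linked R (xs ++ ys) → Linked R xs
linked-++⁻ˡ []           _        = []
linked-++⁻ˡ (x ∷ [])     _        = [-]
linked-++⁻ˡ (x ∷ y ∷ xs) (r ∷ rs) = r ∷ linked-++⁻ˡ (y ∷ xs) rs

avoids-++⁻ : ∀ us {vs} → Avoids (us ++ vs) → Avoids us × Avoids vs
avoids-++⁻ []       av        = tt , av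
avoids-++⁻ (u ∷ us) (na , av) with avoids-++⁻ us av
... | av-us , av-vs = (linked-++⁻ˡ us na , av-us) , av-vs

-- A letter below `x` cannot be followed by one above `x`, and distinctness excludes `x` itself, so
-- the word never climbs back.
allBelow-if-head : ∀ {x y ys} → y < x → NoAscentAcross x (y ∷ ys) → All (x ≢_) ys →
  All (_< x) (y ∷ ys)
allBelow-if-head y<x [-]       []         = y<x ∷ []
allBelow-if-head y<x (¬p ∷ na) (x≢z ∷ ≢s) =
  y<x ∷ allBelow-if-head (≤∧≢⇒< (≮⇒≥ λ x<z → ¬p (y<x , x<z)) (x≢z ∘ sym)) na ≢s

-- `us` is the initial run of letters above `x`. From the first letter below `x` on, everything
-- stays below.
noAscentAcross⇒split : ∀ {x} ys → NoAscentAcross x ys → All (x ≢_) ys →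
  ∃₂ λ us vs → ys ≡ us ++ vs × All (x <_) us × All (_< x) vs
noAscentAcross⇒split         []       _  _           = [] , [] , refl , [] , []
noAscentAcross⇒split {x = x} (y ∷ ys) na (x≢y ∷ x≢s) with <-cmp x y
... | tri≈ _ x≡y _ = contradiction x≡y x≢y
... | tri> _ _ y<x = [] , y ∷ ys , refl , [] , allBelow-if-head y<x na x≢s
... | tri< x<y _ _ with noAscentAcross⇒split ys (Linked.tail na) x≢s
...   | us , vs , refl , <us , vs< = y ∷ us , vs , refl , x<y ∷ <us , vs<

-- The avoiding word of a tree on the letters lo, …, lo + size t - 1.
word : ℕ → Tree → List ℕ
word lo leaf       = []
word lo (node l r) = lo + size l ∷ word (suc (lo + size l)) r ++ word lo l

length-word : ∀ lo t → length (word lo t) ≡ size t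
length-word lo leaf       = refl
length-word lo (node l r) = cong suc (begin
  length (word x r ++ word lo l)         ≡⟨ length-++ (word x r) ⟩
  length (word x r) + length (word lo l) ≡⟨ cong₂ _+_ (length-word x r) (length-word lo l) ⟩
  size r + size l                        ≡⟨ +-comm (size r) (size l) ⟩
  size l + size r                        ∎)
  where
  open ≡-Reasoning
  x = suc (lo + size l)

node-bound : ∀ lo l r → suc (lo + size l) + size r ≡ lo + size (node l r)
node-bound lo l r = lemma lo (size l) (size r)
  where
  lemma : ∀ a b c → suc (a + b) + c ≡ a + suc (b + c)
  lemma = solve-∀

word-bounds : ∀ lo t → All (Between lo (lo + size t)) (word lo t)
word-bounds lo leaf       = []
word-bounds lo (node l r) =
  (lo≤x , x<hi) ∷
  Allₚ.++⁺ (All.map (λ (x<y , y<) → ≤-trans lo≤x (<⇒≤ x<y) , <-≤-trans y< (≤-reflexive hi≡))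
                    (word-bounds (suc x) r))
           (All.map (λ (lo≤y , y<x) → lo≤y , <-trans y<x x<hi) (word-bounds lo l))
  where
  x = lo + size l
  hi≡ = node-bound lo l r
  lo≤x : lo ≤ x
  lo≤x = m≤m+n lo (size l)
  x<hi : x < lo + size (node l r)
  x<hi = <-≤-trans (s≤s (m≤m+n x (size r))) (≤-reflexive hi≡)

module _ (lo : ℕ) (l r : Tree) where
  private x = lo + size l

  word-above : All (x <_) (word (suc x) r)
  word-above = All.map proj₁ (word-bounds (suc x) r)

  word-below : All (_< x) (word lo l)
  word-below = All.map proj₂ (word-bounds lo l)

  word-below-above : All (λ u → All (_< u) (word lo l)) (word (suc x) r)
  word-below-above = All.map (λ x<u → All.map (λ v<x → <-trans v<x x<u) word-below) word-above

word-unique : ∀ lo t → Unique (word lo t)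
word-unique lo leaf       = []
word-unique lo (node l r) =
  Allₚ.++⁺ (All.map <⇒≢ (word-above lo l r)) (All.map >⇒≢ (word-below lo l r)) ∷
  AllPairsₚ.++⁺ (word-unique _ r) (word-unique lo l)
    (All.map (All.map >⇒≢) (word-below-above lo l r))

word-avoids : ∀ lo t → Avoids (word lo t)
word-avoids lo leaf       = tt
word-avoids lo (node l r) =
  noAscentAcross-++⁺ (allAbove⇒noAscentAcross (word-above lo l r)) (word-below lo l r) ,
  avoids-++⁺ _ (word-avoids _ r) (word-avoids lo l) (word-below-above lo l r)

-- The first letter reveals the size of the left subtree and the length then that of the right one,
-- so the rest of the word can be cut at a known place.
word-injective : ∀ lo {t t′} → word lo t ≡ word lo t′ → t ≡ t′
word-injective lo {leaf}     {leaf}       _  = refl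
word-injective lo {node l r} {node l′ r′} eq with ∷-injective eq
... | x≡ , ws≡ = cong₂ node (word-injective lo (proj₂ split))
                            (word-injective x (proj₁ split))
  where
  x = suc (lo + size l)

  l≡ : size l ≡ size l′
  l≡ = +-cancelˡ-≡ lo _ _ x≡

  r≡ : size r ≡ size r′
  r≡ = +-cancelˡ-≡ (size l) _ _
         (trans (cong pred (trans (sym (length-word lo (node l r)))
                           (trans (cong length eq) (length-word lo (node l′ r′)))))
                (cong (_+ size r′) (sym l≡)))

  split : word x r ≡ word x r′ × word lo l ≡ word lo l′
  split = ++-injective (word x r) (word x r′)
    (trans (length-word x r) (trans r≡ (sym (length-word x r′))))
    (trans ws≡ (cong (λ y → word (suc y) r′ ++ word lo l′) (sym x≡)))

-- The letters above and below the first one are decoded into the right and left subtrees. These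
-- blocks come from a split rather than from matching on the list, so the recursion runs on a bound
-- `n` for the length.
avoids⇒word : ∀ n lo xs → length xs ≤ n → Unique xs →
  All (Between lo (lo + length xs)) xs → Avoids xs → ∃ λ t → word lo t ≡ xs
avoids⇒word n       lo []       _         _            _                   _  = leaf , refl
avoids⇒word (suc n) lo (x ∷ xs) (s≤s len) (x≢s ∷ xs!) ((lo≤x , x<hi) ∷ bounds) (na , av)
  with noAscentAcross⇒split xs na x≢s
... | us , vs , refl , us> , vs< = node l r , (begin
    lo + size l ∷ word (suc (lo + size l)) r ++ word lo l
      ≡⟨ cong (λ y → y ∷ word (suc y) r ++ word lo l) lo+size-l≡x ⟩
    x ∷ word (suc x) r ++ word lo l
      ≡⟨ cong₂ (λ as bs → x ∷ as ++ bs) word-r≡us word-l≡vs ⟩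
    x ∷ us ++ vs ∎)
  where
  open ≡-Reasoning
  hi = lo + suc (length (us ++ vs))

  us! = proj₁ (AllPairs-++⁻ us xs!)
  vs! = proj₂ (AllPairs-++⁻ us xs!)

  regroup : ∀ a b c → a + suc (b + c) ≡ suc (a + c) + b
  regroup = solve-∀

  hi≡ : hi ≡ suc (lo + length vs) + length us
  hi≡ = trans (cong (λ y → lo + suc y) (length-++ us)) (regroup lo (length us) (length vs))

  us-bounds : All (Between (suc x) hi) us
  us-bounds = All.zip (us> , All.map proj₂ (Allₚ.++⁻ˡ us bounds))

  vs-bounds : All (Between lo x) vs
  vs-bounds = All.zip (All.map proj₁ (Allₚ.++⁻ʳ us bounds) , vs<)

  -- Counting the letters above and below x pins x down.
  x≡ : x ≡ lo + length vs
  x≡ = ≤-antisym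
    (+-cancelʳ-≤ (length us) _ _ (s≤s⁻¹ (≤-trans (pigeonhole x<hi us! us-bounds) (≤-reflexive hi≡))))
    (pigeonhole lo≤x vs! vs-bounds)

  -- The interval above `x` has exactly as many places as `us` has letters, as the recursive call
  -- demands.
  hi≡x : hi ≡ suc x + length us
  hi≡x = trans hi≡ (cong (λ y → suc y + length us) (sym x≡))

  len′ : length us + length vs ≤ n
  len′ = ≤-trans (≤-reflexive (sym (length-++ us))) len

  right = avoids⇒word n (suc x) us (m+n≤o⇒m≤o _ len′) us!
    (subst (λ h → All (Between (suc x) h) us) hi≡x us-bounds) (proj₁ (avoids-++⁻ us av))
  left = avoids⇒word n lo vs (m+n≤o⇒n≤o (length us) len′) vs!
    (subst (λ h → All (Between lo h) vs) x≡ vs-bounds) (proj₂ (avoids-++⁻ us av))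

  r = proj₁ right
  word-r≡us = proj₂ right
  l = proj₁ left
  word-l≡vs = proj₂ left

  lo+size-l≡x : lo + size l ≡ x
  lo+size-l≡x = trans (cong (lo +_) (trans (sym (length-word lo l)) (cong length word-l≡vs)))
                      (sym x≡)

-- Trees whose words begin with a decreasing run

chain : ℕ → Tree → Tree
chain zero    t = t
chain (suc j) t = node (chain j t) leaf

chain-injective : ∀ j {t t′} → chain j t ≡ chain j t′ → t ≡ t′
chain-injective zero    eq = eq
chain-injective (suc j) eq = chain-injective j (proj₁ (node-injective eq))

size-chain : ∀ j t → size (chain j t) ≡ j + size t
size-chain zero    t = refl
size-chain (suc j) t = cong suc (trans (+-identityʳ _) (size-chain j t))

-- The `j` nodes of the chain write decreasing letters, all above those of `t`. The first letter of
-- `t`, if there is one, extends the run by one more place, whatever `t` is.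
chain-prefix-decreasing : ∀ j t → AllPairs _>_ (take (suc j) (word 0 (chain j t)))
chain-prefix-decreasing zero    leaf       = []
chain-prefix-decreasing zero    (node l r) = [] ∷ []
chain-prefix-decreasing (suc j) t          =
  Allₚ.take⁺ (suc j) (word-below 0 (chain j t) leaf) ∷ chain-prefix-decreasing j t

-- The size hypothesis guarantees that the prefix really has `suc j` letters.
prefix-decreasing⇒chain : ∀ j t → suc j ≤ size t →
  AllPairs _>_ (take (suc j) (word 0 t)) → ∃ λ t′ → t ≡ chain j t′
prefix-decreasing⇒chain zero    t              _       _        = t , refl
prefix-decreasing⇒chain (suc j) (node l leaf)  (s≤s le) (_ ∷ ps) =
  let t′ , eq = prefix-decreasing⇒chain j l (≤-trans le (≤-reflexive (+-identityʳ (size l)))) ps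
  in t′ , cong (λ l → node l leaf) eq
-- A nonempty right subtree is written directly after the root, so the second letter would exceed
-- the first.
prefix-decreasing⇒chain (suc j) (node l (node a b)) _ ((x>y ∷ _) ∷ _) =
  contradiction x>y (≤⇒≯ (m≤n⇒m≤1+n (m≤m+n (size l) (size a))))

-- Permutations as lists of numbers

letters : ∀ {n m} → Vec (Fin n) m → List ℕ
letters π = toList (Vec.map toℕ π)

letters-injective : ∀ {n m} {π ρ : Vec (Fin n) m} → letters π ≡ letters ρ → π ≡ ρ
letters-injective {π = []}    {[]}    _  = refl
letters-injective {π = _ ∷ _} {_ ∷ _} eq with ∷-injective eq
... | a≡b , eq′ = cong₂ _∷_ (toℕ-injective a≡b) (letters-injective eq′)

letters-surjective : ∀ {n} m xs → length xs ≡ m → All (_< n) xs →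
  ∃ λ (π : Vec (Fin n) m) → letters π ≡ xs
letters-surjective zero    []       _   _          = [] , refl
letters-surjective (suc m) (x ∷ xs) len (x< ∷ xs<) =
  let π , eq = letters-surjective m xs (cong pred len) xs<
  in fromℕ< x< ∷ π , cong₂ _∷_ (toℕ-fromℕ< x<) eq

length-letters : ∀ {n m} (π : Vec (Fin n) m) → length (letters π) ≡ m
length-letters π = length-toList (Vec.map toℕ π)

letters<n : ∀ {n m} (π : Vec (Fin n) m) → All (_< n) (letters π)
letters<n []      = []
letters<n (i ∷ π) = toℕ<n i ∷ letters<n π

letters-∉⁺ : ∀ {n m} {i : Fin n} {π : Vec (Fin n) m} →
  VecAll.All (i ≢_) π → All (toℕ i ≢_) (letters π)
letters-∉⁺ = VecAllₚ.toList⁺ ∘ VecAllₚ.map⁺ ∘ VecAll.map (_∘ toℕ-injective)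

letters-unique⁺ : ∀ {n m} {π : Vec (Fin n) m} →
  VecAllPairs.AllPairs _≢_ π → Unique (letters π)
letters-unique⁺ VecAllPairs.[]         = []
letters-unique⁺ (i∉ VecAllPairs.∷ π!) = letters-∉⁺ i∉ ∷ letters-unique⁺ π!

letters-unique⁻ : ∀ {n m} {π : Vec (Fin n) m} →
  Unique (letters π) → VecAllPairs.AllPairs _≢_ π
letters-unique⁻ {π = []}    _         = VecAllPairs.[]
letters-unique⁻ {π = i ∷ π} (i∉ ∷ π!) =
  VecAll.map (_∘ cong toℕ) (VecAllₚ.map⁻ (VecAllₚ.toList⁻ i∉)) VecAllPairs.∷ letters-unique⁻ π!

-- Patterns, from positions to lists

LinkedAt : ∀ {m} → (ℕ → ℕ → Set) → Vec ℕ m → Set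
LinkedAt R v = ∀ j j′ → toℕ j′ ≡ suc (toℕ j) → R (lookup v j) (lookup v j′)

linkedAt⇒linked : ∀ {R m} (v : Vec ℕ m) → LinkedAt R v → Linked R (toList v)
linkedAt⇒linked []          _  = []
linkedAt⇒linked (x ∷ [])    _  = [-]
linkedAt⇒linked (x ∷ y ∷ v) rs =
  rs Fin.zero (Fin.suc Fin.zero) refl ∷
  linkedAt⇒linked (y ∷ v) (λ j j′ eq → rs (Fin.suc j) (Fin.suc j′) (cong suc eq))

linked⇒linkedAt : ∀ {R m} (v : Vec ℕ m) → Linked R (toList v) → LinkedAt R v
linked⇒linkedAt (x ∷ y ∷ v) (r ∷ rs) Fin.zero    (Fin.suc Fin.zero) _  = r
linked⇒linkedAt (x ∷ y ∷ v) (r ∷ rs) (Fin.suc j) (Fin.suc j′)       eq =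
  linked⇒linkedAt (y ∷ v) rs j j′ (cong pred eq)

-- A halfway form between `Avoids-2-13`, which speaks of positions and order isomorphism, and the
-- recursive `Avoids`.
AvoidsAt : ∀ {m} → Vec ℕ m → Set
AvoidsAt v = ∀ i j j′ → i Fin.< j → toℕ j′ ≡ suc (toℕ j) →
  ¬ (lookup v j < lookup v i × lookup v i < lookup v j′)

avoidsAt⇒avoids : ∀ {m} (v : Vec ℕ m) → AvoidsAt v → Avoids (toList v)
avoidsAt⇒avoids []      _  = tt
avoidsAt⇒avoids (x ∷ v) av =
  linkedAt⇒linked v (λ j j′ eq → av Fin.zero (Fin.suc j) (Fin.suc j′) z<s (cong suc eq)) ,
  avoidsAt⇒avoids v (λ i j j′ i<j eq →
    av (Fin.suc i) (Fin.suc j) (Fin.suc j′) (s<s i<j) (cong suc eq))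

avoids⇒avoidsAt : ∀ {m} (v : Vec ℕ m) → Avoids (toList v) → AvoidsAt v
avoids⇒avoidsAt (x ∷ v) (na , _) Fin.zero    (Fin.suc j) (Fin.suc j′) _   eq =
  linked⇒linkedAt v na j j′ (cong pred eq)
avoids⇒avoidsAt (x ∷ v) (_ , av) (Fin.suc i) (Fin.suc j) (Fin.suc j′) i<j eq =
  avoids⇒avoidsAt v av i j j′ (s<s⁻¹ i<j) (cong pred eq)

-- Each of the nine pairs of positions is strictly increasing in both words or in neither.
iso-213⁺ : ∀ {a b c} → b < a → a < c → OrderIsomorphic (a ∷ b ∷ c ∷ []) (2 ∷ 1 ∷ 3 ∷ [])
iso-213⁺ {a} {b} {c} b<a a<c = go
  where
  both : ∀ {x y x′ y′} → x < y → x′ < y′ → (x < y) ⇔ (x′ < y′)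
  both p q = mk⇔ (λ _ → q) (λ _ → p)
  neither : ∀ {x y x′ y′} → y ≤ x → y′ ≤ x′ → (x < y) ⇔ (x′ < y′)
  neither p q = mk⇔ (λ r → contradiction r (≤⇒≯ p)) (λ r → contradiction r (≤⇒≯ q))
  1≤2 = s≤s (z≤n {1})
  1<3 : 1 < 3
  1<3 = s≤s (s≤s z≤n)
  go : OrderIsomorphic (a ∷ b ∷ c ∷ []) (2 ∷ 1 ∷ 3 ∷ [])
  go Fin.zero                      Fin.zero                      = neither ≤-refl ≤-refl
  go Fin.zero                      (Fin.suc Fin.zero)            = neither (<⇒≤ b<a) 1≤2
  go Fin.zero                      (Fin.suc (Fin.suc Fin.zero))  = both a<c ≤-refl
  go (Fin.suc Fin.zero)            Fin.zero                      = both b<a ≤-refl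
  go (Fin.suc Fin.zero)            (Fin.suc Fin.zero)            = neither ≤-refl ≤-refl
  go (Fin.suc Fin.zero)            (Fin.suc (Fin.suc Fin.zero))  = both (<-trans b<a a<c) 1<3
  go (Fin.suc (Fin.suc Fin.zero))  Fin.zero                      = neither (<⇒≤ a<c) (n≤1+n 2)
  go (Fin.suc (Fin.suc Fin.zero))  (Fin.suc Fin.zero)            =
    neither (<⇒≤ (<-trans b<a a<c)) (<⇒≤ 1<3)
  go (Fin.suc (Fin.suc Fin.zero))  (Fin.suc (Fin.suc Fin.zero))  = neither ≤-refl ≤-refl

iso-213⁻ : ∀ {a b c} → OrderIsomorphic (a ∷ b ∷ c ∷ []) (2 ∷ 1 ∷ 3 ∷ []) → b < a × a < c
-- The two uses of `≤-refl` prove 1 < 2 and 2 < 3 in the pattern.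
iso-213⁻ iso = Equivalence.from (iso (Fin.suc Fin.zero) Fin.zero) ≤-refl ,
               Equivalence.from (iso Fin.zero (Fin.suc (Fin.suc Fin.zero))) ≤-refl

avoids-2-13⇒avoids : ∀ {n} (π : Vec (Fin n) n) → Avoids-2-13 π → Avoids (letters π)
avoids-2-13⇒avoids π av = avoidsAt⇒avoids (Vec.map toℕ π) λ i j j′ i<j j′≡ (b<a , a<c) →
  av (i , j , j′ , i<j , j′≡ ,
      iso-213⁺ (subst₂ _<_ (lookup-map j toℕ π) (lookup-map i toℕ π) b<a)
               (subst₂ _<_ (lookup-map i toℕ π) (lookup-map j′ toℕ π) a<c))

avoids⇒avoids-2-13 : ∀ {n} (π : Vec (Fin n) n) → Avoids (letters π) → Avoids-2-13 π
avoids⇒avoids-2-13 π av (i , j , j′ , i<j , j′≡ , iso) with iso-213⁻ iso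
... | b<a , a<c = avoids⇒avoidsAt (Vec.map toℕ π) av i j j′ i<j j′≡
  (subst₂ _<_ (sym (lookup-map j toℕ π)) (sym (lookup-map i toℕ π)) b<a ,
   subst₂ _<_ (sym (lookup-map i toℕ π)) (sym (lookup-map j′ toℕ π)) a<c)

lookup-decreasing≤ : ∀ k i → lookup (decreasing k) i ≤ k
lookup-decreasing≤ (suc k) Fin.zero    = ≤-refl
lookup-decreasing≤ (suc k) (Fin.suc i) = m≤n⇒m≤1+n (lookup-decreasing≤ k i)

-- The tail of `decreasing (suc k)` is `decreasing k`, with letters at most `k` and so below the
-- head. Hence this direction and its converse go by recursion on the word.
iso-decreasing⁻ : ∀ {k} (v : Vec ℕ k) → OrderIsomorphic v (decreasing k) →
  AllPairs _>_ (toList v)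
iso-decreasing⁻         []      _   = []
iso-decreasing⁻ {suc k} (x ∷ v) iso =
  VecAllₚ.toList⁺ (VecAllₚ.lookup⁻ λ i →
    Equivalence.from (iso (Fin.suc i) Fin.zero) (s≤s (lookup-decreasing≤ k i))) ∷
  iso-decreasing⁻ v (λ a b → iso (Fin.suc a) (Fin.suc b))

iso-decreasing⁺ : ∀ {k} (v : Vec ℕ k) → AllPairs _>_ (toList v) →
  OrderIsomorphic v (decreasing k)
iso-decreasing⁺ (x ∷ v) _ Fin.zero Fin.zero =
  mk⇔ (λ p → contradiction p (<-irrefl refl)) (λ p → contradiction p (<-irrefl refl))
iso-decreasing⁺ {suc k} (x ∷ v) (x> ∷ _) Fin.zero (Fin.suc b) =
  mk⇔ (λ p → contradiction p (<-asym (VecAllₚ.lookup⁺ (VecAllₚ.toList⁻ x>) b)))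
      (λ p → contradiction p (<-asym (s≤s (lookup-decreasing≤ k b))))
iso-decreasing⁺ {suc k} (x ∷ v) (x> ∷ _) (Fin.suc a) Fin.zero =
  mk⇔ (λ _ → s≤s (lookup-decreasing≤ k a)) (λ _ → VecAllₚ.lookup⁺ (VecAllₚ.toList⁻ x>) a)
iso-decreasing⁺ (x ∷ v) (_ ∷ ps) (Fin.suc a) (Fin.suc b) = iso-decreasing⁺ v ps a b

letters-truncate : ∀ {n m k} (k≤m : k ≤ m) (π : Vec (Fin n) m) →
  letters (truncate k≤m π) ≡ take k (letters π)
letters-truncate z≤n       π       = refl
letters-truncate (s≤s k≤m) (i ∷ π) = cong (toℕ i ∷_) (letters-truncate k≤m π)

-- Counting permutations by trees

words-complete : ∀ {n} m (v : Vec (Fin n) m) → v ∈ words n m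
words-complete zero    []      = here refl
words-complete (suc m) (i ∷ v) = ∈-cartesianProductWith⁺ _∷_ (∈-allFin i) (words-complete m v)

words-unique : ∀ n m → Unique (words n m)
words-unique n zero    = [] ∷ []
words-unique n (suc m) =
  Uniqueₚ.cartesianProductWith⁺ _∷_ ∷ᵛ-injective (Uniqueₚ.allFin⁺ n) (words-unique n m)

letters⇒word : ∀ {n} (π : Vec (Fin n) n) → IsPermutation π → Avoids-2-13 π →
  ∃ λ t → word 0 t ≡ letters π × size t ≡ n
letters⇒word {n} π π! av = t , eq , (begin
  size t              ≡⟨ length-word 0 t ⟨
  length (word 0 t)   ≡⟨ cong length eq ⟩
  length (letters π)  ≡⟨ length-letters π ⟩
  n                   ∎)
  where
  open ≡-Reasoning
  decoded = avoids⇒word (length (letters π)) 0 (letters π) ≤-refl (letters-unique⁺ π!)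
    (All.map (λ x<n → z≤n , <-≤-trans x<n (≤-reflexive (sym (length-letters π)))) (letters<n π))
    (avoids-2-13⇒avoids π av)
  t  = proj₁ decoded
  eq = proj₂ decoded

counted⇒chain : ∀ j {n} (π : Vec (Fin n) n) → suc j ≤ n → Counted (decreasing (suc j)) π →
  ∃ λ t → letters π ≡ word 0 (chain j t) × j + size t ≡ n
-- The convention concerns the empty permutation only, which is too short here.
counted⇒chain j π j<n (_ , _ , inj₂ (refl , _)) = contradiction j<n λ ()
counted⇒chain j π j<n (π! , av , inj₁ (k≤n , iso)) with letters⇒word π π! av
... | t , eq , refl
  with prefix-decreasing⇒chain j t j<n
         (subst (AllPairs _>_) (trans (letters-truncate k≤n π) (cong (take (suc j)) (sym eq)))
                (iso-decreasing⁻ _ iso))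
...   | t′ , refl = t′ , sym eq , sym (size-chain j t′)

chain⇒counted : ∀ j {n} t → suc j ≤ n → j + size t ≡ n →
  ∃ λ (π : Vec (Fin n) n) → letters π ≡ word 0 (chain j t) × Counted (decreasing (suc j)) π
chain⇒counted j {n} t j<n n≡ = π , eq ,
  letters-unique⁻ (subst Unique (sym eq) (word-unique 0 (chain j t))) ,
  avoids⇒avoids-2-13 π (subst Avoids (sym eq) (word-avoids 0 (chain j t))) ,
  inj₁ (j<n , iso-decreasing⁺ _ (subst (AllPairs _>_)
    (sym (trans (letters-truncate j<n π) (cong (take (suc j)) eq)))
    (chain-prefix-decreasing j t)))
  where
  size≡n : size (chain j t) ≡ n
  size≡n = trans (size-chain j t) n≡
  encoded = letters-surjective n (word 0 (chain j t)) (trans (length-word 0 (chain j t)) size≡n)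
    (All.map (λ (_ , x<) → <-≤-trans x< (≤-reflexive size≡n)) (word-bounds 0 (chain j t)))
  π  = proj₁ encoded
  eq = proj₂ encoded

-- With k = `suc j`, writing n as `j + suc m` builds in n ≥ k, and the tree below the chain has
-- `suc m` = n - k + 1 nodes. Permutations and trees are compared through their lists of letters.
N-2-13-decreasing : ∀ j m → N-2-13 (decreasing (suc j)) (j + suc m) ≡ catalan (suc m)
N-2-13-decreasing j m = begin
  length perms                      ≡⟨ length-map letters perms ⟨
  length (List.map letters perms)   ≡⟨ length-cong-∈ perms! chains! to from ⟩
  length (List.map toWord (trees (suc m)))  ≡⟨ length-map toWord (trees (suc m)) ⟩
  length (trees (suc m))            ≡⟨ length-trees (suc m) ⟩
  catalan (suc m)                   ∎
  where
  open ≡-Reasoning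
  n = j + suc m
  j<n : suc j ≤ n
  j<n = ≤-trans (m≤m+n (suc j) m) (≤-reflexive (sym (+-suc j m)))

  ctd? = counted? (decreasing (suc j))
  perms = filter ctd? (words n n)
  toWord = λ t → word 0 (chain j t)

  perms! : Unique (List.map letters perms)
  perms! = Uniqueₚ.map⁺ letters-injective (Uniqueₚ.filter⁺ ctd? (words-unique n n))

  chains! : Unique (List.map toWord (trees (suc m)))
  chains! = Uniqueₚ.map⁺ (chain-injective j ∘ word-injective 0) (trees-unique (suc m))

  to : ∀ {xs} → xs ∈ List.map letters perms → xs ∈ List.map toWord (trees (suc m))
  to xs∈ with ∈-map⁻ letters xs∈
  ... | π , π∈ , refl
    with counted⇒chain j π j<n (proj₂ (∈-filter⁻ ctd? {xs = words n n} π∈))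
  ...   | t , eq , n≡ = subst (_∈ _) (sym eq)
    (∈-map⁺ toWord (∈-trees⁺ (+-cancelˡ-≡ j _ _ n≡)))

  from : ∀ {xs} → xs ∈ List.map toWord (trees (suc m)) → xs ∈ List.map letters perms
  from xs∈ with ∈-map⁻ toWord xs∈
  ... | t , t∈ , refl with chain⇒counted j t j<n (cong (j +_) (∈-trees⁻ t∈))
  ...   | π , eq , c = subst (_∈ _) eq
    (∈-map⁺ letters (∈-filter⁺ ctd? (words-complete n π) c))

¬beginsWith-longer : ∀ {k n} (π : Vec (Fin n) n) → n < k → ¬ (k ≡ 1 × n ≡ 0) →
  ¬ BeginsWith (decreasing k) π
¬beginsWith-longer π n<k _       (inj₁ (k≤n , _))    = <⇒≱ n<k k≤n
¬beginsWith-longer {k} π n<k nonempty (inj₂ (n≡0 , dec≡)) =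
  -- Comparing lengths shows that the convention applies to k = 1 alone.
  nonempty (trans (sym (length-toList (decreasing k))) (cong length dec≡) , n≡0)

-- For k = 1 and n = 0 the convention makes the count 1, so the value 0 for n < k would fail there.
proposition7 : (k : ℕ) → k ≥ 1 → (n : ℕ) → ¬ (k ≡ 1 × n ≡ 0) →
    (n ≥ k → N-2-13 (decreasing k) n ≡ catalan (n ∸ k + 1)) ×
    (n < k → N-2-13 (decreasing k) n ≡ 0)
proposition7 (suc j) _ n nonempty = long , short
  where
  long : n ≥ suc j → N-2-13 (decreasing (suc j)) n ≡ catalan (n ∸ suc j + 1)
  -- The tree size `suc m` is taken with `m` = `n ∸ suc j`, which gives back `n` because k ≤ n.
  long k≤n = subst₂ (λ n c → N-2-13 (decreasing (suc j)) n ≡ catalan c)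
    (trans (+-suc j (n ∸ suc j)) (m+[n∸m]≡n k≤n))
    (+-comm 1 (n ∸ suc j))
    (N-2-13-decreasing j (n ∸ suc j))

  short : n < suc j → N-2-13 (decreasing (suc j)) n ≡ 0
  short n<k = cong length (filter-none (counted? (decreasing (suc j)))
    (All.universal (λ π (_ , _ , b) → ¬beginsWith-longer π n<k nonempty b) (words n n)))
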